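{- Let $\mu$ be a partition and let $D\subseteq\{(i,j)\in\mu: i>1\}$. Let $$F_{\mu,D}(x;q)=\sum_{\sigma\colon\mu\to\mathbb Z_+,\ \operatorname{Des}(\sigma)=D}q^{|\operatorname{Inv}(\sigma)|}x^\sigma ,$$ and let $\boldsymbol\nu(\mu,D)=(\nu^{(1)},\dots,\nu^{(k)})$, $k=\mu_1$, be the tuple of ribbons in which $\nu^{(j)}$ has size $\mu'_j$, cell contents $\{1,2,\dots,\mu'_j\}$, and descent set $\operatorname{Des}(\nu^{(j)})=\{i:(i,j)\in D\}$. Then $$F_{\mu,D}(x;q)=G_{\boldsymbol\nu(\mu,D)}(x;q),$$ where $G_{\boldsymbol\nu}(x;q)$ denotes the LLT polynomial indexed by $\boldsymbol\nu$.
   Context: **Fillings.** $\mathbb Z_+=\{1,2,\dots\}$. For a partition $\mu=(\mu_1\ge\dots\ge\mu_l)$ with transpose $\mu'$, its diagram is $\{(i,j)\in\mathbb Z_+\times\mathbb Z_+: j\le\mu_i\}$, identified with $\mu$; $(i,j)$ is the cell in row $i$, column $j$, and rows are numbered from bottom to top (French convention), so $(i+1,j)$ is directly above $(i,j)$. A filling is a function $\sigma\colon\mu\to\mathbb Z_+$, and $x^\sigma=\prod_{u\in\mu}x_{\sigma(u)}$. $\operatorname{Des}(\sigma)$ is the set of cells $u=(i+1,j)\in\mu$ such that $\sigma(u)>\sigma(v)$, where $v=(i,j)$. Two cells attack each other if either they are two distinct cells in the same row, or they have the form $(i+1,k)$ and $(i,j)$ with $j<k$. The reading order is the total order on cells row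 by row, from top to bottom, left to right within each row. $\operatorname{Inv}(\sigma)$ is the set of pairs $\{u,v\}$ of attacking cells with $u$ preceding $v$ in reading order and $\sigma(u)>\sigma(v)$. **LLT polynomials.** A skew diagram is a subset of $\mathbb Z_+\times\mathbb Z_+$ of the form $\lambda\setminus\mu$ for partition diagrams $\mu\subseteq\lambda$ (translates are not identified). The content of a cell $u=(i,j)$ is $c(u)=i-j$. A semistandard tableau of skew shape $\nu$ is a function $T\colon\nu\to\mathbb Z_+$ weakly increasing along rows (left to right) and strictly increasing up columns; $\operatorname{SSYT}(\nu)$ is the set of these. For a tuple of skew diagrams $\boldsymbol\nu=(\nu^{(1)},\dots,\nu^{(k)})$, $\operatorname{SSYT}(\boldsymbol\nu)=\operatorname{SSYT}(\nu^{(1)})\times\dots\times\operatorname{SSYT}(\nu^{(k)})$, and for $T=(T^{(1)},\dots,T^{(k)})$, $x^T=\prod_j\prod_{u\in\nu^{(j)}}x_{T^{(j)}(u)}$. Entries $T^{(i)}(u)>T^{(j)}(v)$ form an inversion if either $i<j$ and $c(u)=c(v)$, or $i>j$ and $c(u)=c(v)+1$; $\operatorname{inv}(T)$ is the number of inversions. The LLT polynomial is $G_{\boldsymbol\nu}(x;q)=\sum_{T\in\operatorname{SSYT}(\boldsymbol\nu)}q^{\operatorname{inv}(T)}x^T$. **Ribbons.** A ribbon is a connected skew diagram containing no $2\times2$ block of cells. Only ribbons positioned so that the lower-right cell has content $1$ are considered; then the contents of the cells are $1,2,\dots,m$, each occurring once, where $m$ is the size. The descent set $\operatorname{Des}(\nu)$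 of a ribbon $\nu$ is the set of contents $c(u)$ of those cells $u=(i,j)\in\nu$ such that the cell $(i-1,j)$ directly below also belongs to $\nu$. Ribbons of size $m$ correspond one-to-one to descent sets contained in $\{2,\dots,m\}$. -}

module Defs where

open import Data.Bool.Properties using () renaming (_≟_ to _≟ᵇ_)
open import Data.Fin using (Fin; toℕ)
open import Data.Fin.Properties using (∀-cons; all?; any?)
open import Data.Fin.Subset using (Subset; _∈_)
open import Data.Integer using (ℤ; +_; 1ℤ; _⊖_) renaming (_+_ to _+ᶻ_; _≤_ to _≤ᶻ_)
open import Data.Integer.Properties using () renaming (_≟_ to _≟ᶻ_)
open import Data.List using (List; []; _∷_; allFin; cartesianProduct; cartesianProductWith;
  concatMap; filter; length; lookup; map; upTo)
open import Data.List.Relation.Unary.All using (All)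
open import Data.List.Relation.Unary.Linked using (Linked)
open import Data.Nat using (ℕ; zero; suc; _≤_; _<_; _≥_; _≤?_; _<?_; _≟_)
open import Data.Product using (Σ-syntax; ∃-syntax; _×_; _,_; proj₁; proj₂)
open import Data.Sum using (_⊎_)
open import Data.Vec using (Vec; tabulate)
open import Data.Vec.Properties using (≡-dec)
open import Function using (_∘_; _⇔_)
open import Level using (0ℓ)
open import Relation.Binary.Construct.Closure.ReflexiveTransitive using (Star)
open import Relation.Binary.PropositionalEquality using (_≡_; _≢_)
open import Relation.Nullary using (¬_; Dec; does)
open import Relation.Nullary.Decidable using (¬?; _×-dec_; _⊎-dec_; _→-dec_)
open import Relation.Unary using (Pred; Decidable)

import Data.Fin as Fin

------------------------------------------------------------------------
-- Formal power series

-- A power series in q and x₁, x₂, … with coefficients in ℕ: `f α n` is the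
-- coefficient of qⁿ x₁^α₁ ⋯ x_N^α_N, for exponent vectors of any length N.
-- Every monomial in the infinitely many variables has this form.
Series : Set
Series = ∀ {N} → Vec ℕ N → ℕ → ℕ

infix 4 _≈_

_≈_ : Series → Series → Set
f ≈ g = ∀ {N} (α : Vec ℕ N) (n : ℕ) → f α n ≡ g α n

count : {A : Set} {P : Pred A 0ℓ} → Decidable P → List A → ℕ
count P? = length ∘ filter P?

-- The coefficient of qⁿ x^α in the finite sum of q^(stat t) x^(weight t)
-- over the entries t of a list.
coefficient : ∀ {A : Set} {N} → List A → (stat : A → ℕ) (weight : A → Vec ℕ N) →
              Vec ℕ N → ℕ → ℕ
coefficient ts stat weight α n =
  count (λ t → (stat t ≟ n) ×-dec ≡-dec _≟_ (weight t) α) ts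

-- All choice functions, each listed once if each `xs i` has no repetitions.
choices : ∀ {n} {A : Fin n → Set} → (∀ i → List (A i)) → List (∀ i → A i)
choices {zero}  xs = (λ ()) ∷ []
choices {suc n} xs = cartesianProductWith ∀-cons (xs Fin.zero) (choices (xs ∘ Fin.suc))

------------------------------------------------------------------------
-- Partitions and diagrams

record Partition : Set where
  field
    parts      : List ℕ
    positive   : All (0 <_) parts
    decreasing : Linked _≥_ parts

open Partition public

-- Rows and columns are numbered from 1, so there is no row 0.
nth : List ℕ → ℕ → ℕ
nth _        zero          = 0
nth []       (suc _)       = 0
nth (a ∷ _)  (suc zero)    = a
nth (_ ∷ as) (suc (suc i)) = nth as (suc i)

part : Partition → ℕ → ℕ
part μ = nth (parts μ)

transposePart : Partition → ℕ → ℕ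
transposePart μ j = count (j ≤?_) (parts μ)

-- (row , column), rows numbered from bottom to top.
Cell : Set
Cell = ℕ × ℕ

infix 4 _∈ᵖ_ _∈ᵖ?_ _∈ˢ_ _∈ˢ?_

_∈ᵖ_ : Cell → Partition → Set
(i , j) ∈ᵖ μ = 1 ≤ j × j ≤ part μ i

_∈ᵖ?_ : ∀ u μ → Dec (u ∈ᵖ μ)
(i , j) ∈ᵖ? μ = (1 ≤? j) ×-dec (j ≤? part μ i)

-- The rectangle with length μ rows and μ₁ columns; it contains the diagram of μ.
boundingBox : Partition → List Cell
boundingBox μ =
  cartesianProduct (map suc (upTo (length (parts μ)))) (map suc (upTo (part μ 1)))

diagram : Partition → List Cell
diagram μ = filter (_∈ᵖ? μ) (boundingBox μ)

record SkewDiagram : Set where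
  field
    outer inner : Partition
    inner⊆outer : ∀ u → u ∈ᵖ inner → u ∈ᵖ outer

open SkewDiagram public

_∈ˢ_ : Cell → SkewDiagram → Set
u ∈ˢ ν = u ∈ᵖ outer ν × ¬ (u ∈ᵖ inner ν)

_∈ˢ?_ : ∀ u ν → Dec (u ∈ˢ ν)
u ∈ˢ? ν = (u ∈ᵖ? outer ν) ×-dec ¬? (u ∈ᵖ? inner ν)

skewDiagram : SkewDiagram → List Cell
skewDiagram ν = filter (_∈ˢ? ν) (boundingBox (outer ν))

cellContent : Cell → ℤ
cellContent (i , j) = i ⊖ j

------------------------------------------------------------------------
-- Fillings, descents, inversions, semistandard tableaux

module _ (d : List Cell) where

  -- Cells of a diagram are referred to by their position in the (repetition-free)
  -- list of cells, so that sets of cells and functions on cells are finite objects.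
  Box : Set
  Box = Fin (length d)

  row col : Box → ℕ
  row u = proj₁ (lookup d u)
  col u = proj₂ (lookup d u)

  content : Box → ℤ
  content u = cellContent (lookup d u)

  -- Functions from the cells to {1,…,N}, with Fin N in the role of {1,…,N}.
  -- Only such functions contribute to coefficients of monomials in x₁,…,x_N.
  Filling : ℕ → Set
  Filling N = Box → Fin N

  fillings : ∀ N → List (Filling N)
  fillings N = choices (λ _ → allFin N)

  Attack : Box → Box → Set
  Attack u v = (row u ≡ row v × u ≢ v)
             ⊎ (row u ≡ suc (row v) × col v < col u)
             ⊎ (row v ≡ suc (row u) × col u < col v)

  attack? : ∀ u v → Dec (Attack u v)
  attack? u v = ((row u ≟ row v) ×-dec ¬? (u Fin.≟ v))
          ⊎-dec ((row u ≟ suc (row v)) ×-dec (col v <? col u))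
          ⊎-dec ((row v ≟ suc (row u)) ×-dec (col u <? col v))

  -- Reading order.
  Precedes : Box → Box → Set
  Precedes u v = row v < row u ⊎ (row u ≡ row v × col u < col v)

  precedes? : ∀ u v → Dec (Precedes u v)
  precedes? u v = (row v <? row u) ⊎-dec ((row u ≟ row v) ×-dec (col u <? col v))

  module _ {N : ℕ} (σ : Filling N) where

    -- The exponent vector of x^σ.
    weight : Vec ℕ N
    weight = tabulate (λ i → count (λ u → σ u Fin.≟ i) (allFin (length d)))

    IsDescent : Box → Set
    IsDescent u = ∃[ v ] row u ≡ suc (row v) × col u ≡ col v × σ v Fin.< σ u

    isDescent? : ∀ u → Dec (IsDescent u)
    isDescent? u = any? λ v →
      (row u ≟ suc (row v)) ×-dec (col u ≟ col v) ×-dec (σ v Fin.<? σ u)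

    Des : Subset (length d)
    Des = tabulate (λ u → does (isDescent? u))

    IsInversion : Box × Box → Set
    IsInversion (u , v) = Attack u v × Precedes u v × σ v Fin.< σ u

    isInversion? : ∀ p → Dec (IsInversion p)
    isInversion? (u , v) = attack? u v ×-dec precedes? u v ×-dec (σ v Fin.<? σ u)

    -- A pair {u , v} is counted once, in the orientation given by reading order.
    ∣Inv∣ : ℕ
    ∣Inv∣ = count isInversion? (cartesianProduct (allFin (length d)) (allFin (length d)))

    IsSemistandard : Set
    IsSemistandard = ∀ u v →
      (row u ≡ row v → col u < col v → σ u Fin.≤ σ v) ×
      (col u ≡ col v → row u < row v → σ u Fin.< σ v)

    isSemistandard? : Dec IsSemistandard
    isSemistandard? = all? λ u → all? λ v →
      ((row u ≟ row v) →-dec (col u <? col v) →-dec (σ u Fin.≤? σ v)) ×-dec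
      ((col u ≟ col v) →-dec (row u <? row v) →-dec (σ u Fin.<? σ v))

module _ (μ : Partition) (D : Subset (length (diagram μ))) where

  F : Series
  F {N} = coefficient (filter (λ σ → ≡-dec _≟ᵇ_ (Des (diagram μ) σ) D) (fillings (diagram μ) N))
                      (∣Inv∣ (diagram μ)) (weight (diagram μ))

------------------------------------------------------------------------
-- LLT polynomials

SSYT : ∀ ν N → List (Filling (skewDiagram ν) N)
SSYT ν N = filter (isSemistandard? (skewDiagram ν)) (fillings (skewDiagram ν) N)

module _ {k : ℕ} (ν : Fin k → SkewDiagram) where

  TupleBox : Set
  TupleBox = Σ[ j ∈ Fin k ] Box (skewDiagram (ν j))

  tupleBoxes : List TupleBox
  tupleBoxes = concatMap (λ j → map (j ,_) (allFin (length (skewDiagram (ν j))))) (allFin k)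

  tupleContent : TupleBox → ℤ
  tupleContent (j , u) = content (skewDiagram (ν j)) u

  TupleFilling : ℕ → Set
  TupleFilling N = ∀ j → Filling (skewDiagram (ν j)) N

  tupleSSYT : ∀ N → List (TupleFilling N)
  tupleSSYT N = choices (λ j → SSYT (ν j) N)

  module _ {N : ℕ} (T : TupleFilling N) where

    entry : TupleBox → Fin N
    entry (j , u) = T j u

    tupleWeight : Vec ℕ N
    tupleWeight = tabulate (λ i → count (λ u → entry u Fin.≟ i) tupleBoxes)

    IsTupleInversion : TupleBox × TupleBox → Set
    IsTupleInversion (u , v) = entry v Fin.< entry u ×
      ((proj₁ u Fin.< proj₁ v × tupleContent u ≡ tupleContent v) ⊎
       (proj₁ v Fin.< proj₁ u × tupleContent u ≡ tupleContent v +ᶻ 1ℤ))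

    isTupleInversion? : ∀ p → Dec (IsTupleInversion p)
    isTupleInversion? (u , v) = (entry v Fin.<? entry u) ×-dec
      (((proj₁ u Fin.<? proj₁ v) ×-dec (tupleContent u ≟ᶻ tupleContent v)) ⊎-dec
       ((proj₁ v Fin.<? proj₁ u) ×-dec (tupleContent u ≟ᶻ tupleContent v +ᶻ 1ℤ)))

    inv : ℕ
    inv = count isTupleInversion? (cartesianProduct tupleBoxes tupleBoxes)

  G : Series
  G {N} = coefficient (tupleSSYT N) inv tupleWeight

------------------------------------------------------------------------
-- Ribbons

Adjacent : Cell → Cell → Set
Adjacent (i , j) (i′ , j′) = (i ≡ i′ × (j′ ≡ suc j ⊎ j ≡ suc j′))
                           ⊎ (j ≡ j′ × (i′ ≡ suc i ⊎ i ≡ suc i′))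

Connected : SkewDiagram → Set
Connected ν = ∀ u v → u ∈ˢ ν → v ∈ˢ ν →
  Star (λ a b → a ∈ˢ ν × b ∈ˢ ν × Adjacent a b) u v

record IsRibbon (ν : SkewDiagram) : Set where
  field
    connected : Connected ν
    no2×2     : ∀ i j → ¬ ((i , j) ∈ˢ ν × (i , suc j) ∈ˢ ν ×
                           (suc i , j) ∈ˢ ν × (suc i , suc j) ∈ˢ ν)

RibbonDes : SkewDiagram → Pred ℤ 0ℓ
RibbonDes ν c = ∃[ i ] ∃[ j ]
  (suc i , j) ∈ˢ ν × (i , j) ∈ˢ ν × c ≡ cellContent (suc i , j)

-- ν is the ribbon attached to column j of μ. These conditions determine ν up to
-- translation along the diagonal, which changes neither contents nor tableaux.
record IsColumnRibbon (μ : Partition) (D : Subset (length (diagram μ)))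
                      (j : ℕ) (ν : SkewDiagram) : Set where
  field
    isRibbon : IsRibbon ν
    size     : length (skewDiagram ν) ≡ transposePart μ j
    contents : ∀ c → (∃[ u ] u ∈ˢ ν × c ≡ cellContent u) ⇔
               (1ℤ ≤ᶻ c × c ≤ᶻ + transposePart μ j)
    descents : ∀ c → RibbonDes ν c ⇔
               (∃[ u ] u ∈ D × col (diagram μ) u ≡ j × c ≡ + row (diagram μ) u)

-- ν = ν(μ, D). The tuple is indexed by 0, …, μ₁ - 1, the columns by 1, …, μ₁.
IsRibbonTuple : (μ : Partition) → Subset (length (diagram μ)) →
                (Fin (part μ 1) → SkewDiagram) → Set
IsRibbonTuple μ D ν = ∀ j → IsColumnRibbon μ D (suc (toℕ j)) (ν j)

{-# OPTIONS --safe #-}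

-- Match the cell (i , j) of μ with the cell of content i of the ribbon ν⁽ʲ⁾, so that
-- fillings of μ correspond to tuples of fillings of the ribbons. Attacking pairs become
-- pairs counted by inv, and weights agree. Cells of contents c and c + 1 in a ribbon are
-- adjacent: the second lies above the first if c + 1 is in the descent set and to its left
-- otherwise, so a filling is semistandard exactly when its descents along increasing
-- contents are those of the ribbon, which is the condition Des σ = D.

module Submission where

open import Defs
open import Data.Bool using (true)
open import Data.Bool.Properties using () renaming (_≟_ to _≟ᵇ_)
open import Data.Fin using (Fin; toℕ)
open import Data.Fin.Properties
  using (injective⇒≤; <-cmp; any?; ∀-cons; toℕ<n; toℕ-injective; toℕ-fromℕ<)
open import Data.Fin.Subset using (Subset; _∈_)
open import Data.Fin.Subset.Properties using (⊆-antisym)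
open import Data.Integer using (+_; 1ℤ; +≤+; _⊖_) renaming (_≤_ to _≤ᶻ_; _+_ to _+ᶻ_)
open import Data.Integer.Properties using ([1+m]⊖[1+n]≡m⊖n; ⊖-≥; +-injective)
open import Data.List using (List; []; _∷_; allFin; cartesianProductWith;
  filter; length; lookup; map; upTo)
open import Data.List.Membership.Propositional using (find; lose) renaming (_∈_ to _∈ˡ_)
open import Data.List.Membership.Propositional.Properties using (∈-lookup; ∈-filter⁺; ∈-filter⁻;
  ∈-map⁺; ∈-map⁻; ∈-upTo⁺; ∈-cartesianProduct⁺; ∈-allFin; ∈-concatMap⁺)
open import Data.List.Properties using (filter-accept; filter-none; length-filter)
open import Data.List.Relation.Binary.Disjoint.Propositional using (Disjoint)
open import Data.List.Relation.Unary.All as All using (All; []; _∷_)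
open import Data.List.Relation.Unary.AllPairs as AllPairs using (AllPairs; []; _∷_)
open import Data.List.Relation.Unary.Any as Any using (Any; here; index)
open import Data.List.Relation.Unary.Linked.Properties using (Linked⇒AllPairs)
open import Data.List.Relation.Unary.Unique.Propositional using (Unique)
open import Data.Nat using (ℕ; zero; suc; _≤_; _<_; _≥_; _≤?_; _≟_; z≤n; s≤s; _+_; _∸_)
open import Data.Nat.Properties hiding (<-cmp; _≟_; _≤?_)
open import Data.Product using (∃-syntax; _×_; _,_; proj₁; proj₂)
open import Data.Sum using (_⊎_; inj₁; inj₂)
open import Data.Vec using (tabulate)
open import Data.Vec.Properties
  using (≡-dec; lookup∘tabulate; []=⇒lookup; lookup⇒[]=; tabulate-cong)
open import Function using (_∘_; _⇔_; mk⇔; Equivalence)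
open import Level using (0ℓ)
open import Relation.Binary.Construct.Closure.ReflexiveTransitive using (Star; ε; _◅_)
open import Relation.Binary.Definitions using (tri<; tri≈; tri>)
open import Relation.Binary.PropositionalEquality
  using (_≡_; _≢_; refl; sym; trans; cong; cong₂; subst; subst₂; setoid)
open import Relation.Nullary using (¬_; Dec; does; yes; no; contradiction)
open import Relation.Nullary.Decidable using (dec-true; _×-dec_)
open import Relation.Unary using (Pred; Decidable)

import Data.Fin as Fin
import Data.List.Relation.Unary.All.Properties as All
import Data.List.Relation.Unary.AllPairs.Properties as AllPairs
import Data.List.Relation.Unary.Any.Properties as Any
import Data.List.Relation.Unary.Unique.Propositional.Properties as Unique

open Equivalence using (to; from)

-- Counting through a relation without shared partners

module _ {A : Set} {R : A → A → Set} where

  lookup-< : ∀ {xs} → AllPairs R xs → ∀ {i j} → i Fin.< j → R (lookup xs i) (lookup xs j)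
  lookup-< (rs ∷ _) {Fin.zero}  {Fin.suc j} _         = All.lookup rs (∈-lookup j)
  lookup-< (_ ∷ ps) {Fin.suc i} {Fin.suc j} (s≤s i<j) = lookup-< ps i<j

lookup-injective : ∀ {A : Set} {xs : List A} → Unique xs → ∀ {i j} → lookup xs i ≡ lookup xs j → i ≡ j
lookup-injective u {i} {j} eq with <-cmp i j
... | tri< i<j _ _ = contradiction eq (lookup-< u i<j)
... | tri≈ _ i≡j _ = i≡j
... | tri> _ _ j<i = contradiction (sym eq) (lookup-< u j<i)

module _ {A B : Set} (R : A → B → Set) where

  -- Sending each entry of `xs` to the position of one of its partners in `ys` is injective, since
  -- no partner is shared. Separation under `R` stands in for the absence of repetitions, so that
  -- functions need only be compared pointwise.
  length-≤ : ∀ {xs ys} → AllPairs (λ x x′ → ∀ y → R x y → ¬ R x′ y) xs →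
             All (λ x → Any (R x) ys) xs → length xs ≤ length ys
  length-≤ {xs} {ys} sep images = injective⇒≤ position-injective
    where
    image : ∀ i → Any (R (lookup xs i)) ys
    image i = All.lookup images (∈-lookup i)

    related : ∀ i → R (lookup xs i) (lookup ys (index (image i)))
    related i = Any.lookup-index (image i)

    position-injective : ∀ {i j} → index (image i) ≡ index (image j) → i ≡ j
    position-injective {i} {j} eq with <-cmp i j
    ... | tri≈ _ i≡j _ = i≡j
    ... | tri< i<j _ _ = contradiction
      (subst (λ k → R (lookup xs j) (lookup ys k)) (sym eq) (related j)) (lookup-< sep i<j _ (related i))
    ... | tri> _ _ j<i = contradiction
      (subst (λ k → R (lookup xs i) (lookup ys k)) eq (related i)) (lookup-< sep j<i _ (related j))

  module _ {P : Pred A 0ℓ} {Q : Pred B 0ℓ} (P? : Decidable P) (Q? : Decidable Q) where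

    count-≤ : ∀ {xs ys} → AllPairs (λ x x′ → ∀ y → R x y → ¬ R x′ y) xs →
              (∀ {x} → x ∈ˡ xs → P x → ∃[ y ] y ∈ˡ ys × Q y × R x y) →
              count P? xs ≤ count Q? ys
    count-≤ {xs} {ys} sep image = length-≤ (AllPairs.filter⁺ P? sep) (All.tabulate any-image)
      where
      any-image : ∀ {x} → x ∈ˡ filter P? xs → Any (R x) (filter Q? ys)
      any-image x∈ with x∈xs , px ← ∈-filter⁻ P? x∈ with y , y∈ys , qy , r ← image x∈xs px =
        Any.map (λ { refl → r }) (∈-filter⁺ Q? y∈ys qy)

-- This takes the place of a bijection: weights, inversion numbers and the coefficients themselves
-- are compared by giving partners in both directions.
count-≡ : ∀ {A B : Set} (R : A → B → Set) {P : Pred A 0ℓ} {Q : Pred B 0ℓ}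
          (P? : Decidable P) (Q? : Decidable Q) {xs ys} →
          AllPairs (λ x x′ → ∀ y → R x y → ¬ R x′ y) xs →
          AllPairs (λ y y′ → ∀ x → R x y → ¬ R x y′) ys →
          (∀ {x} → x ∈ˡ xs → P x → ∃[ y ] y ∈ˡ ys × Q y × R x y) →
          (∀ {y} → y ∈ˡ ys → Q y → ∃[ x ] x ∈ˡ xs × P x × R x y) →
          count P? xs ≡ count Q? ys
count-≡ R P? Q? sepˡ sepʳ toʳ toˡ =
  ≤-antisym (count-≤ R P? Q? sepˡ toʳ) (count-≤ (λ y x → R x y) Q? P? sepʳ toˡ)

-- Lists of choice functions

choices-All : ∀ {n} {A : Fin n → Set} {P : ∀ i → A i → Set} (xs : ∀ i → List (A i)) →
              (∀ i → All (P i) (xs i)) → All (λ f → ∀ i → P i (f i)) (choices xs)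
choices-All {zero}  xs ps = (λ ()) ∷ []
choices-All {suc n} {P = P} xs ps =
  All.cartesianProductWith⁺ (setoid _) (setoid _) ∀-cons (xs Fin.zero) (choices (xs ∘ Fin.suc))
    λ x∈ f∈ → ∀-cons (All.lookup (ps Fin.zero) x∈)
                     (All.lookup (choices-All (xs ∘ Fin.suc) (ps ∘ Fin.suc)) f∈)

choices-Any : ∀ {n} {A : Fin n → Set} {P : ∀ i → A i → Set} (xs : ∀ i → List (A i)) →
              (∀ i → Any (P i) (xs i)) → Any (λ f → ∀ i → P i (f i)) (choices xs)
choices-Any {zero}  xs ps = here (λ ())
choices-Any {suc n} xs ps = Any.cartesianProductWith⁺ ∀-cons ∀-cons
  (ps Fin.zero) (choices-Any (xs ∘ Fin.suc) (ps ∘ Fin.suc))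

-- Without function extensionality, choice functions are only distinct up to a given
-- relation on the values.
choices-distinct : ∀ {n} {A : Fin n → Set} {S : ∀ i → A i → A i → Set} (xs : ∀ i → List (A i)) →
                   (∀ i → AllPairs (λ x y → ¬ S i x y) (xs i)) →
                   AllPairs (λ f g → ¬ (∀ i → S i (f i) (g i))) (choices xs)
choices-distinct {zero}  xs ds = [] ∷ []
choices-distinct {suc n} {A} {S} xs ds = go (ds Fin.zero)
  where
  fs : List (∀ i → A (Fin.suc i))
  fs = choices (xs ∘ Fin.suc)

  go : ∀ {zs} → AllPairs (λ x y → ¬ S Fin.zero x y) zs →
       AllPairs (λ f g → ¬ (∀ i → S i (f i) (g i))) (cartesianProductWith ∀-cons zs fs)
  go [] = []
  -- Two functions starting with `z` differ on the tail by recursion; functions whose first values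
  -- come from different positions already differ at index zero.
  go {z ∷ zs} (d ∷ ds′) = AllPairs.++⁺
    (AllPairs.map⁺ (AllPairs.map (λ ¬s s → ¬s (s ∘ Fin.suc)) (choices-distinct (xs ∘ Fin.suc) (ds ∘ Fin.suc))))
    (go ds′)
    (All.map⁺ (All.tabulate λ _ → All.cartesianProductWith⁺ (setoid _) (setoid _) ∀-cons zs fs
      λ z′∈ _ s → All.lookup d z′∈ (s Fin.zero)))

-- Partitions and their diagrams

nth-≤ : ∀ {a as} → All (a ≥_) as → ∀ i → nth as i ≤ a
nth-≤ _        zero          = z≤n
nth-≤ []       (suc _)       = z≤n
nth-≤ (b ∷ _)  (suc zero)    = b
nth-≤ (_ ∷ bs) (suc (suc i)) = nth-≤ bs (suc i)

-- The parts decrease weakly, so those that are at least `j` form an initial segment of the list,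
-- and `count` is its length.
≤nth⇔≤count : ∀ {as} → AllPairs _≥_ as → ∀ {j} → 1 ≤ j → ∀ i →
              j ≤ nth as (suc i) ⇔ suc i ≤ count (j ≤?_) as
≤nth⇔≤count [] 1≤j i = mk⇔ (λ j≤0 → contradiction (≤-trans 1≤j j≤0) λ ()) λ ()
≤nth⇔≤count {a ∷ as} (ps ∷ pss) {j} 1≤j i with j ≤? a
... | no j≰a
  rewrite filter-none (j ≤?_) {a ∷ as} (j≰a ∷ All.map (λ b≤a j≤b → j≰a (≤-trans j≤b b≤a)) ps) =
  mk⇔ (λ j≤ → contradiction (≤-trans j≤ (nth-≤ (≤-refl ∷ ps) (suc i))) j≰a) λ ()
... | yes j≤a rewrite filter-accept (j ≤?_) {a} {as} j≤a with i
...   | zero   = mk⇔ (λ _ → s≤s z≤n) (λ _ → j≤a)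
...   | suc i′ = mk⇔ (s≤s ∘ to rec) (λ { (s≤s h) → from rec h })
  where rec = ≤nth⇔≤count pss 1≤j i′

∈ᵖ⇔≤transposePart : ∀ μ i j → (i , j) ∈ᵖ μ ⇔ (1 ≤ i × 1 ≤ j × i ≤ transposePart μ j)
∈ᵖ⇔≤transposePart μ zero    _ = mk⇔ (λ (1≤j , j≤0) → contradiction (≤-trans 1≤j j≤0) λ ()) λ { (() , _) }
∈ᵖ⇔≤transposePart μ (suc i) _ = mk⇔
  (λ (1≤j , j≤) → s≤s z≤n , 1≤j , to (equiv 1≤j) j≤)
  (λ (_ , 1≤j , i<) → 1≤j , from (equiv 1≤j) i<)
  where
  equiv : ∀ {j} → 1 ≤ j → j ≤ part μ (suc i) ⇔ suc i ≤ transposePart μ j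
  equiv 1≤j = ≤nth⇔≤count (Linked⇒AllPairs (λ b≤a c≤b → ≤-trans c≤b b≤a) (decreasing μ)) 1≤j i

∈ᵖ-below : ∀ μ {i j} → (suc (suc i) , j) ∈ᵖ μ → (suc i , j) ∈ᵖ μ
∈ᵖ-below μ {i} {j} u∈ with _ , 1≤j , i≤ ← to (∈ᵖ⇔≤transposePart μ _ j) u∈ =
  from (∈ᵖ⇔≤transposePart μ _ j) (s≤s z≤n , 1≤j , ≤-trans (n≤1+n _) i≤)

∈ᵖ⇒≤part₁ : ∀ μ {i j} → (i , j) ∈ᵖ μ → j ≤ part μ 1
∈ᵖ⇒≤part₁ μ {i} {j} u∈ with 1≤i , 1≤j , i≤ ← to (∈ᵖ⇔≤transposePart μ i j) u∈ =
  proj₂ (from (∈ᵖ⇔≤transposePart μ 1 j) (≤-refl , 1≤j , ≤-trans 1≤i i≤))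

∈-suc-upTo : ∀ {i n} → 1 ≤ i → i ≤ n → i ∈ˡ map suc (upTo n)
∈-suc-upTo (s≤s _) i≤n = ∈-map⁺ suc (∈-upTo⁺ i≤n)

∈-boundingBox : ∀ μ {u} → u ∈ᵖ μ → u ∈ˡ boundingBox μ
∈-boundingBox μ {i , j} u∈ with 1≤i , 1≤j , i≤ ← to (∈ᵖ⇔≤transposePart μ i j) u∈ =
  ∈-cartesianProduct⁺ (∈-suc-upTo 1≤i (≤-trans i≤ (length-filter (j ≤?_) (parts μ))))
                      (∈-suc-upTo 1≤j (∈ᵖ⇒≤part₁ μ {i} {j} u∈))

boundingBox-unique : ∀ μ → Unique (boundingBox μ)
boundingBox-unique μ = Unique.cartesianProduct⁺
  (Unique.map⁺ suc-injective (Unique.upTo⁺ (length (parts μ))))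
  (Unique.map⁺ suc-injective (Unique.upTo⁺ (part μ 1)))

module _ {P : Pred Cell 0ℓ} (P? : Decidable P) {d : List Cell} where

  lookup-filter : ∀ u → P (lookup (filter P? d) u)
  lookup-filter u = proj₂ (∈-filter⁻ P? {xs = d} (∈-lookup {xs = filter P? d} u))

  index-filter : ∀ {x} → x ∈ˡ d → P x → ∃[ u ] lookup (filter P? d) u ≡ x
  index-filter x∈d px = index x∈ , sym (Any.lookup-index x∈)
    where x∈ = ∈-filter⁺ P? x∈d px

-- Contents and paths in skew diagrams

⊖≡⇒≡+ : ∀ i j {c} → i ⊖ j ≡ + c → i ≡ c + j
⊖≡⇒≡+ zero    zero    refl = refl
⊖≡⇒≡+ (suc i) zero    refl = sym (+-identityʳ _)
⊖≡⇒≡+ zero    (suc j) ()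
⊖≡⇒≡+ (suc i) (suc j) eq = trans (cong suc (⊖≡⇒≡+ i j (trans (sym ([1+m]⊖[1+n]≡m⊖n i j)) eq)))
                                 (sym (+-suc _ j))

cellContent-+ : ∀ c j → cellContent (c + j , j) ≡ + c
cellContent-+ c j = trans (⊖-≥ (m≤n+m j c)) (cong +_ (m+n∸n≡m c j))

+-≡-<⇒> : ∀ {a b x y} → a + x ≡ b + y → x < y → b < a
+-≡-<⇒> eq x<y = ≰⇒> λ a≤b → <-irrefl eq (+-mono-≤-< a≤b x<y)

positive-range : ∀ {z m} → 1ℤ ≤ᶻ z → z ≤ᶻ + m → ∃[ c ] z ≡ + c × 1 ≤ c × c ≤ m
positive-range (+≤+ 1≤c) (+≤+ c≤m) = _ , refl , 1≤c , c≤m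

-- Each step of a path changes the content by one, so it cannot jump over c and c + 1.
crossing : ∀ ν c {i j i′ j′} →
           Star (λ a b → a ∈ˢ ν × b ∈ˢ ν × Adjacent a b) (i , j) (i′ , j′) →
           i ≤ c + j → c + j′ < i′ →
           ∃[ l ] (suc c + l , l) ∈ˢ ν × ((c + l , l) ∈ˢ ν ⊎ (suc c + l , suc l) ∈ˢ ν)
crossing ν c ε i≤ <i = contradiction i≤ (<⇒≱ <i)
crossing ν c {i} {j} (_◅_ {j = k , l} (a∈ , b∈ , adj) path) i≤ <i′ with k ≤? c + l
... | yes k≤ = crossing ν c path k≤ <i′
... | no  k≰ with ≰⇒> k≰ | adj
-- Right and down steps lower the content and cannot cross. For left and up steps the two bounds
-- squeeze the content of the first cell to exactly `c`.
...   | <k | inj₁ (refl , inj₁ refl) =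
  contradiction i≤ (<⇒≱ (≤-trans (s≤s (+-monoʳ-≤ c (n≤1+n j))) <k))
...   | <k | inj₁ (refl , inj₂ refl) with refl ← ≤-antisym (≤-trans i≤ (≤-reflexive (+-suc c l))) <k =
  l , b∈ , inj₂ a∈
...   | <k | inj₂ (refl , inj₁ refl) with refl ← ≤-antisym i≤ (≤-pred <k) = l , b∈ , inj₁ a∈
...   | <k | inj₂ (refl , inj₂ refl) = contradiction i≤ (<⇒≱ (≤-trans <k (n≤1+n k)))

-- Cells of the partition diagram

module _ (μ : Partition) where

  private
    d = diagram μ

  cell-injective : ∀ {u v} → row d u ≡ row d v → col d u ≡ col d v → u ≡ v
  cell-injective r≡ c≡ =
    lookup-injective (Unique.filter⁺ (_∈ᵖ? μ) (boundingBox-unique μ)) (cong₂ _,_ r≡ c≡)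

  cell-∈ᵖ : ∀ u → lookup d u ∈ᵖ μ
  cell-∈ᵖ = lookup-filter (_∈ᵖ? μ) {boundingBox μ}

  cell-at : ∀ {x} → x ∈ᵖ μ → ∃[ u ] lookup d u ≡ x
  cell-at {x} x∈ = index-filter (_∈ᵖ? μ) (∈-boundingBox μ {x} x∈) x∈

  cell-below : ∀ {u} → 1 < row d u → ∃[ v ] row d u ≡ suc (row d v) × col d u ≡ col d v
  cell-below {u} 1<r = go (lookup d u) refl (cell-∈ᵖ u) 1<r
    where
    go : ∀ x → lookup d u ≡ x → x ∈ᵖ μ → 1 < proj₁ x →
         ∃[ v ] row d u ≡ suc (row d v) × col d u ≡ col d v
    go (suc zero , _) _ _ (s≤s ())
    go (suc (suc i) , j) eq x∈ _ with v , v≡ ← cell-at {suc i , j} (∈ᵖ-below μ x∈) =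
      v , trans (cong proj₁ eq) (cong (suc ∘ proj₁) (sym v≡)) , trans (cong proj₂ eq) (cong proj₂ (sym v≡))

  Matches : ℕ → ∀ ν → Box d → Box (skewDiagram ν) → Set
  Matches j ν u b = col d u ≡ j × content (skewDiagram ν) b ≡ + row d u

-- The ribbon of one column

module _ {μ : Partition} {D : Subset (length (diagram μ))} {j : ℕ} {ν : SkewDiagram}
         (ribbon : IsColumnRibbon μ D j ν) where

  open IsColumnRibbon ribbon

  private
    cells = skewDiagram ν

  box : ∀ {x} → x ∈ˢ ν → ∃[ b ] lookup cells b ≡ x
  box x∈ = index-filter (_∈ˢ? ν) (∈-boundingBox (outer ν) (proj₁ x∈)) x∈

  box-∈ˢ : ∀ b → lookup cells b ∈ˢ ν
  box-∈ˢ = lookup-filter (_∈ˢ? ν) {boundingBox (outer ν)}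

  box-content : ∀ b → ∃[ c ] content cells b ≡ + c × 1 ≤ c × c ≤ transposePart μ j
  box-content b with 1≤ , ≤m ← to (contents _) (_ , box-∈ˢ b , refl) = positive-range 1≤ ≤m

  box-at : ∀ {c} → 1 ≤ c → c ≤ transposePart μ j → ∃[ b ] content cells b ≡ + c
  box-at 1≤c c≤ with x , x∈ , c≡ ← from (contents _) (+≤+ 1≤c , +≤+ c≤) with b , x≡ ← box {x} x∈ =
    b , trans (cong cellContent x≡) (sym c≡)

  private
    boxOf : Fin (transposePart μ j) → Box cells
    boxOf k = proj₁ (box-at (s≤s z≤n) (toℕ<n k))

    boxOf-content : ∀ k → content cells (boxOf k) ≡ + suc (toℕ k)
    boxOf-content k = proj₂ (box-at (s≤s z≤n) (toℕ<n k))

    boxOf-injective : ∀ {k k′} → boxOf k ≡ boxOf k′ → k ≡ k′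
    boxOf-injective {k} {k′} eq = toℕ-injective (suc-injective (+-injective
      (trans (sym (boxOf-content k)) (trans (cong (content cells) eq) (boxOf-content k′)))))

    -- The boxes at contents 1, …, m already exhaust the m cells.
    boxOf-surjective : ∀ b → ∃[ k ] boxOf k ≡ b
    boxOf-surjective b with any? (λ k → boxOf k Fin.≟ b)
    ... | yes b∈ = b∈
    ... | no  b∉ = contradiction
      (subst (transposePart μ j <_) size (injective⇒≤ extended-injective)) (<-irrefl refl)
      where
      extended : Fin (suc (transposePart μ j)) → Box cells
      extended = ∀-cons b boxOf

      extended-injective : ∀ {k k′} → extended k ≡ extended k′ → k ≡ k′
      extended-injective {Fin.zero}  {Fin.zero}   _  = refl
      extended-injective {Fin.zero}  {Fin.suc k′} eq = contradiction (k′ , sym eq) b∉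
      extended-injective {Fin.suc k} {Fin.zero}   eq = contradiction (k , eq) b∉
      extended-injective {Fin.suc k} {Fin.suc k′} eq = cong Fin.suc (boxOf-injective eq)

  -- Every box is some `boxOf k`, and these have the distinct contents 1, ..., m, so a content
  -- determines its box.
  content-injective : ∀ {b b′} → content cells b ≡ content cells b′ → b ≡ b′
  content-injective {b} {b′} eq
    with k , refl ← boxOf-surjective b | k′ , refl ← boxOf-surjective b′ =
    cong boxOf (toℕ-injective (suc-injective (+-injective
      (trans (sym (boxOf-content k)) (trans eq (boxOf-content k′))))))

  -- In both relations the second box is the neighbour of larger content: it lies above, or to the
  -- left of, the first.
  Above Left : Box cells → Box cells → Set
  Above b b′ = row cells b′ ≡ suc (row cells b) × col cells b′ ≡ col cells b
  Left  b b′ = row cells b′ ≡ row cells b × col cells b ≡ suc (col cells b′)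

  private
    lookup-content : ∀ x {b c} → x ∈ˢ ν → cellContent x ≡ + c → content cells b ≡ + c →
                     lookup cells b ≡ x
    lookup-content x x∈ x≡ b≡ with b₀ , eq ← box {x} x∈ =
      trans (cong (lookup cells) (content-injective
              (trans b≡ (trans (sym x≡) (cong cellContent (sym eq)))))) eq

  -- A path from `b` to `b′` inside the ribbon must pass between contents `c` and `c + 1` somewhere;
  -- since contents determine boxes, that step joins `b` and `b′` themselves.
  consecutive : ∀ {b b′ c} → content cells b ≡ + c → content cells b′ ≡ + suc c →
                (Above b b′ × RibbonDes ν (+ suc c)) ⊎ (Left b b′ × ¬ RibbonDes ν (+ suc c))
  consecutive {b} {b′} {c} b≡ b′≡
    with crossing ν c (IsRibbon.connected isRibbon _ _ (box-∈ˢ b) (box-∈ˢ b′))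
           (≤-reflexive (⊖≡⇒≡+ (row cells b) (col cells b) b≡))
           (≤-reflexive (sym (⊖≡⇒≡+ (row cells b′) (col cells b′) b′≡)))
  ... | l , y∈ , inj₁ x∈
    with eq  ← lookup-content (c + l , l) x∈ (cellContent-+ c l) b≡
       | eq′ ← lookup-content (suc c + l , l) y∈ (cellContent-+ (suc c) l) b′≡ =
    inj₁ ( (trans (cong proj₁ eq′) (cong (suc ∘ proj₁) (sym eq)) , trans (cong proj₂ eq′) (cong proj₂ (sym eq)))
         , (_ , _ , y∈ , x∈ , sym (cellContent-+ (suc c) l)))
  ... | l , y∈ , inj₂ x∈
    with eq  ← lookup-content (suc c + l , suc l) x∈
                 (trans (cong (_⊖ suc l) (sym (+-suc c l))) (cellContent-+ c (suc l))) b≡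
       | eq′ ← lookup-content (suc c + l , l) y∈ (cellContent-+ (suc c) l) b′≡ =
    inj₂ ( (trans (cong proj₁ eq′) (cong proj₁ (sym eq)) , trans (cong proj₂ eq) (cong (suc ∘ proj₂) (sym eq′)))
         -- A descent of content `c + 1` would consist of `b` and `b′` again, now in different rows,
         -- though here they share one.
         , λ (r , k , y′∈ , x′∈ , c≡) →
             let r≡  = suc-injective (⊖≡⇒≡+ (suc r) k (sym c≡))
                 b∼  = lookup-content (r , k) x′∈ (trans (cong (_⊖ k) r≡) (cellContent-+ c k)) b≡
                 b′∼ = lookup-content (suc r , k) y′∈ (sym c≡) b′≡
             in 1+n≢n (trans (sym (cong proj₁ b′∼)) (trans (trans (cong proj₁ eq′) (cong proj₁ (sym eq)))
                                                          (cong proj₁ b∼))))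

  -- Semistandardness along increasing contents

  module _ {N} (T : Filling cells N) where

    -- Only neighbouring contents are compared, which is what the descents within one column of `μ`
    -- record.
    IsLocallySemistandard : Set
    IsLocallySemistandard = ∀ {b b′ c} → content cells b ≡ + c → content cells b′ ≡ + suc c →
      (RibbonDes ν (+ suc c) → T b Fin.< T b′) × (¬ RibbonDes ν (+ suc c) → T b′ Fin.≤ T b)

    semistandard⇒locally : IsSemistandard cells T → IsLocallySemistandard
    semistandard⇒locally ss {b} {b′} b≡ b′≡ with consecutive b≡ b′≡
    ... | inj₁ ((r≡ , c≡) , des) =
      (λ _ → proj₂ (ss b b′) (sym c≡) (≤-reflexive (sym r≡))) , contradiction des
    ... | inj₂ ((r≡ , c≡) , ¬des) =
      (λ des → contradiction des ¬des) , λ _ → proj₁ (ss b′ b) r≡ (≤-reflexive (sym c≡))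

    module _ (local : IsLocallySemistandard) where

      -- Along increasing contents rows weakly increase and columns weakly decrease, so
      -- between two cells of the same row all steps go left, and of the same column up.
      chain : ∀ n {b b′ c} → content cells b ≡ + c → content cells b′ ≡ + (n + c) →
              row cells b ≤ row cells b′ × col cells b′ ≤ col cells b ×
              (row cells b ≡ row cells b′ → T b′ Fin.≤ T b) ×
              (col cells b ≡ col cells b′ → n + toℕ (T b) ≤ toℕ (T b′))
      chain zero b≡ b′≡ with refl ← content-injective (trans b≡ (sym b′≡)) =
        ≤-refl , ≤-refl , (λ _ → ≤-refl) , λ _ → ≤-refl
      chain (suc n) {b} {b′} {c} b≡ b′≡
        with _ , b≡₂ , 1≤c , _  ← box-content b
           | _ , b′≡₂ , _ , ≤m ← box-content b′
        with refl ← trans (sym b≡) b≡₂ | refl ← trans (sym b′≡) b′≡₂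
        -- The box of content `n + c` exists because this number lies between the contents of `b`
        -- and `b′`, both in the range 1, ..., `transposePart μ j`.
        with b″ , b″≡ ← box-at (≤-trans 1≤c (m≤n+m c n)) (≤-trans (n≤1+n _) ≤m)
        with r≤ , ≤c , rowT , colT ← chain n b≡ b″≡ | consecutive b″≡ b′≡
      ... | inj₁ ((r≡ , c≡) , des) =
          ≤-trans r≤ (≤-trans (n≤1+n _) (≤-reflexive (sym r≡)))
        , ≤-trans (≤-reflexive c≡) ≤c
        -- After an up step the row of `b′` exceeds that of `b`, so equal rows are impossible; a
        -- left step likewise excludes equal columns.
        , (λ req → contradiction (≤-trans (≤-reflexive (sym (trans req r≡))) r≤) 1+n≰n)
        , λ ceq → ≤-trans (s≤s (colT (trans ceq c≡))) (proj₁ (local b″≡ b′≡) des)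
      ... | inj₂ ((r≡ , c≡) , ¬des) =
          ≤-trans r≤ (≤-reflexive (sym r≡))
        , ≤-trans (n≤1+n _) (≤-trans (≤-reflexive (sym c≡)) ≤c)
        , (λ req → ≤-trans (proj₂ (local b″≡ b′≡) ¬des) (rowT (trans req r≡)))
        , λ ceq → contradiction (≤-trans (≤-reflexive (trans (cong suc ceq) (sym c≡))) ≤c) 1+n≰n

      locally⇒semistandard : IsSemistandard cells T
      locally⇒semistandard b b′
        with c , b≡ , _ ← box-content b | c′ , b′≡ , _ ← box-content b′
        with r≡ ← ⊖≡⇒≡+ (row cells b) _ b≡ | r′≡ ← ⊖≡⇒≡+ (row cells b′) _ b′≡ =
          (λ req c< →
            -- In one row a larger column means a smaller content, so the chain runs from `b′` back
            -- to `b`.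
            let c′<c = +-≡-<⇒> (trans (sym r≡) (trans req r′≡)) c<
                n+c′≡c = m∸n+n≡m (<⇒≤ c′<c)
            in proj₁ (proj₂ (proj₂ (chain (c ∸ c′) b′≡ (trans b≡ (cong +_ (sym n+c′≡c)))))) (sym req))
        , (λ ceq r< →
            let c<c′ = +-cancelʳ-< (col cells b) c c′
                         (subst₂ _<_ r≡ (trans r′≡ (cong₂ _+_ (refl {x = c′}) (sym ceq))) r<)
                n+c≡c′ = m∸n+n≡m (<⇒≤ c<c′)
            -- Entries grow by at least the difference of contents, which is positive here; this
            -- gives strictness.
            in ≤-trans (+-monoˡ-≤ (toℕ (T b)) (m<n⇒0<n∸m c<c′))
                 (proj₂ (proj₂ (proj₂ (chain (c′ ∸ c) b≡ (trans b′≡ (cong +_ (sym n+c≡c′)))))) ceq))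

  -- A column of the partition against its ribbon

  private
    d = diagram μ

  -- Column `j` has rows 1, ..., `transposePart μ j`, which is the range of contents of the ribbon.
  box-of : ∀ {u} → col d u ≡ j → ∃[ b ] Matches μ j ν u b
  box-of {u} refl with 1≤i , _ , i≤ ← to (∈ᵖ⇔≤transposePart μ (row d u) (col d u)) (cell-∈ᵖ μ u)
    with b , b≡ ← box-at 1≤i i≤ = b , refl , b≡

  cell-of : 1 ≤ j → ∀ b → ∃[ u ] Matches μ j ν u b
  cell-of 1≤j b with c , b≡ , 1≤c , c≤ ← box-content b
    with u , u≡ ← cell-at μ {c , j} (from (∈ᵖ⇔≤transposePart μ c j) (1≤c , 1≤j , c≤)) =
    u , cong proj₂ u≡ , trans b≡ (cong (+_ ∘ proj₁) (sym u≡))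

  -- Within column `j` the row determines the cell, so the cell of `D` supplied by `descents` is `u`
  -- itself.
  ribbonDes⇔∈ : ∀ {u} → col d u ≡ j → RibbonDes ν (+ row d u) ⇔ u ∈ D
  ribbonDes⇔∈ {u} u≡ = mk⇔
    (λ des → let v , v∈D , v≡ , r≡ = to (descents _) des
             in subst (_∈ D) (cell-injective μ (sym (+-injective r≡)) (trans v≡ (sym u≡))) v∈D)
    (λ u∈D → from (descents _) (u , u∈D , u≡ , refl))

  module _ {N} (σ : Filling d N) (T : Filling cells N)
           (agree : ∀ {u b} → Matches μ j ν u b → σ u ≡ T b) where

    -- Boxes of consecutive contents match vertically adjacent cells of `μ`, so each comparison in
    -- the ribbon is one comparison in column `j`.
    descents⇒locally : 1 ≤ j → (∀ u → u ∈ D ⇔ IsDescent d σ u) → IsLocallySemistandard T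
    descents⇒locally 1≤j des {b} {b′} {c} b≡ b′≡ =
      let u  , u∼b   = cell-of 1≤j b
          u′ , u′∼b′ = cell-of 1≤j b′
      in at-cells u u′ u∼b u′∼b′
      where
      at-cells : ∀ u u′ → Matches μ j ν u b → Matches μ j ν u′ b′ →
                 (RibbonDes ν (+ suc c) → T b Fin.< T b′) × (¬ RibbonDes ν (+ suc c) → T b′ Fin.≤ T b)
      at-cells u u′ u∼b@(cu , u≡) u′∼b′@(cu′ , u′≡) = strict , weak
        where
        c′≡ : + suc c ≡ + row d u′
        c′≡ = trans (sym b′≡) u′≡

        above : row d u′ ≡ suc (row d u)
        above = trans (sym (+-injective c′≡)) (cong suc (+-injective (trans (sym b≡) u≡)))

        u′∈D : RibbonDes ν (+ row d u′) ⇔ u′ ∈ D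
        u′∈D = ribbonDes⇔∈ {u′} cu′

        strict : RibbonDes ν (+ suc c) → T b Fin.< T b′
        strict rd =
          let v , ru′≡ , cu′≡ , σv<σu′ = to (des u′) (to u′∈D (subst (RibbonDes ν) c′≡ rd))
              -- The cell `v` witnessing the descent lies directly below `u′`, and so does `u`.
              v≡u = cell-injective μ {v} {u} (suc-injective (trans (sym ru′≡) above))
                                             (trans (sym cu′≡) (trans cu′ (sym cu)))
          in subst₂ Fin._<_ (trans (cong σ v≡u) (agree {u} {b} u∼b)) (agree {u′} {b′} u′∼b′) σv<σu′

        weak : ¬ RibbonDes ν (+ suc c) → T b′ Fin.≤ T b
        -- If the entries increased, `u′` would be a descent of `σ`, hence in `D`, hence a descent
        -- of the ribbon.
        weak ¬rd = ≮⇒≥ λ Tb<Tb′ → ¬rd (subst (RibbonDes ν) (sym c′≡) (from u′∈D (from (des u′)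
          ( u , above , trans cu′ (sym cu)
          , subst₂ Fin._<_ (sym (agree {u} {b} u∼b)) (sym (agree {u′} {b′} u′∼b′)) Tb<Tb′))))

    locally⇒descents : IsLocallySemistandard T → ∀ {u} → col d u ≡ j → (u ∈ D → 1 < row d u) →
                       u ∈ D ⇔ IsDescent d σ u
    locally⇒descents local {u} cu 1<r = mk⇔ D⇒descent descent⇒D
      where
      D⇒descent : u ∈ D → IsDescent d σ u
      -- The bound on the row yields a cell `v` below `u`; the boxes matching `v` and `u` have
      -- consecutive contents.
      D⇒descent u∈D with v , r≡ , c≡ ← cell-below μ (1<r u∈D)
        with b , u∼b ← box-of {u} cu | b₀ , v∼b₀ ← box-of {v} (trans (sym c≡) cu) =
        v , r≡ , c≡ , subst₂ Fin._<_ (sym (agree v∼b₀)) (sym (agree u∼b))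
          (proj₁ (local (proj₂ v∼b₀) (trans (proj₂ u∼b) (cong +_ r≡)))
            (subst (RibbonDes ν ∘ +_) r≡ (from (ribbonDes⇔∈ cu) u∈D)))

      descent⇒D : IsDescent d σ u → u ∈ D
      descent⇒D (v , r≡ , c≡ , σv<σu)
        with b , u∼b ← box-of {u} cu | b₀ , v∼b₀ ← box-of {v} (trans (sym c≡) cu)
        with b≡ ← trans (proj₂ u∼b) (cong +_ r≡)
        with consecutive (proj₂ v∼b₀) b≡
      ... | inj₁ (_ , des)  = to (ribbonDes⇔∈ cu) (subst (RibbonDes ν ∘ +_) (sym r≡) des)
      -- Away from ribbon descents the entries weakly decrease with content, against the assumed
      -- descent at `u`.
      ... | inj₂ (_ , ¬des) = contradiction (proj₂ (local (proj₂ v∼b₀) b≡) ¬des)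
        (<⇒≱ (subst₂ Fin._<_ (agree v∼b₀) (agree u∼b) σv<σu))

-- Cells of the diagram against boxes of the tuple

∈-tabulate-does : ∀ {n} {P : Pred (Fin n) 0ℓ} (P? : Decidable P) {u} → u ∈ tabulate (does ∘ P?) ⇔ P u
∈-tabulate-does {P = P} P? {u} = mk⇔
  (λ u∈ → does⇒ (P? u) (trans (sym (lookup∘tabulate (does ∘ P?) u)) ([]=⇒lookup u∈)))
  (λ pu → lookup⇒[]= u _ (trans (lookup∘tabulate (does ∘ P?) u) (dec-true (P? u) pu)))
  where
  does⇒ : (p? : Dec (P u)) → does p? ≡ true → P u
  does⇒ (yes p) _ = p

module _ {μ : Partition} {D : Subset (length (diagram μ))} {ν : Fin (part μ 1) → SkewDiagram}
         (ribbons : IsRibbonTuple μ D ν) where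

  private
    d = diagram μ

  infix 4 _∼_

  _∼_ : Box d → TupleBox ν → Set
  u ∼ (j , b) = Matches μ (suc (toℕ j)) (ν j) u b

  ∼-total : ∀ u → ∃[ t ] u ∼ t
  ∼-total u with 1≤j , _ ← cell-∈ᵖ μ u | j≤ ← ∈ᵖ⇒≤part₁ μ {row d u} {col d u} (cell-∈ᵖ μ u) =
    (j , proj₁ (box-of (ribbons j) j≡)) , proj₂ (box-of (ribbons j) j≡)
    where
    positive⇒suc : ∀ {m n} → 1 ≤ m → m ≤ n → ∃[ k ] m ≡ suc (toℕ {n} k)
    positive⇒suc (s≤s _) m≤n = Fin.fromℕ< m≤n , cong suc (sym (toℕ-fromℕ< m≤n))

    j : Fin (part μ 1)
    j = proj₁ (positive⇒suc 1≤j j≤)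

    j≡ : col d u ≡ suc (toℕ j)
    j≡ = proj₂ (positive⇒suc 1≤j j≤)

  ∼-surjective : ∀ t → ∃[ u ] u ∼ t
  ∼-surjective (j , b) = cell-of (ribbons j) (s≤s z≤n) b

  ∼-injectiveˡ : ∀ {u v t} → u ∼ t → v ∼ t → u ≡ v
  ∼-injectiveˡ (cu , ru) (cv , rv) =
    cell-injective μ (+-injective (trans (sym ru) rv)) (trans cu (sym cv))

  ∼-injectiveʳ : ∀ {u s t} → u ∼ s → u ∼ t → s ≡ t
  ∼-injectiveʳ {s = j , _} (cj , cs) (cj′ , ct)
    with refl ← toℕ-injective (suc-injective (trans (sym cj) cj′)) =
    cong (j ,_) (content-injective (ribbons j) (trans cs (sym ct)))

  private
    boxesAt : Fin (part μ 1) → List (TupleBox ν)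
    boxesAt j = map (j ,_) (allFin (length (skewDiagram (ν j))))

  ∈-tupleBoxes : ∀ t → t ∈ˡ tupleBoxes ν
  ∈-tupleBoxes (j , b) = ∈-concatMap⁺ boxesAt (Any.map (λ { refl → ∈-map⁺ (j ,_) (∈-allFin b) }) (∈-allFin j))

  tupleBoxes-unique : Unique (tupleBoxes ν)
  tupleBoxes-unique = Unique.concat⁺
    (All.map⁺ (All.tabulate λ _ → Unique.map⁺ (λ { refl → refl }) (Unique.allFin⁺ _)))
    (AllPairs.map⁺ (AllPairs.map disjoint (Unique.allFin⁺ _)))
    where
    disjoint : ∀ {i j} → i ≢ j → Disjoint (boxesAt i) (boxesAt j)
    disjoint i≢j (t∈ , t∈′) with _ , _ , refl ← ∈-map⁻ _ t∈ | _ , _ , refl ← ∈-map⁻ _ t∈′ = i≢j refl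

  descents⇒semistandard : ∀ {N} (σ : Filling d N) j (Tⱼ : Filling (skewDiagram (ν j)) N) →
                          (∀ {u b} → u ∼ (j , b) → σ u ≡ Tⱼ b) →
                          Des d σ ≡ D → IsSemistandard (skewDiagram (ν j)) Tⱼ
  descents⇒semistandard σ j Tⱼ agree refl = locally⇒semistandard (ribbons j) Tⱼ
    (descents⇒locally (ribbons j) σ Tⱼ agree (s≤s z≤n) λ u → ∈-tabulate-does (isDescent? d σ))

  module _ {N} (σ : Filling d N) (T : TupleFilling ν N) where

    Agree : Set
    Agree = ∀ {u t} → u ∼ t → σ u ≡ entry ν T t

    module _ (agree : Agree) where

      weight-≡ : weight d σ ≡ tupleWeight ν T
      weight-≡ = tabulate-cong λ i → count-≡ _∼_ (λ u → σ u Fin.≟ i) (λ t → entry ν T t Fin.≟ i)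
        (AllPairs.map (λ u≢v _ u∼t v∼t → u≢v (∼-injectiveˡ u∼t v∼t)) (Unique.allFin⁺ (length d)))
        (AllPairs.map (λ s≢t _ u∼s u∼t → s≢t (∼-injectiveʳ u∼s u∼t)) tupleBoxes-unique)
        (λ {u} _ σu≡i → let t , u∼t = ∼-total u
                        in t , ∈-tupleBoxes t , trans (sym (agree u∼t)) σu≡i , u∼t)
        (λ {t} _ Tt≡i → let u , u∼t = ∼-surjective t
                        in u , ∈-allFin u , trans (agree u∼t) Tt≡i , u∼t)

      inversion⇔ : ∀ {u v s t} → u ∼ s → v ∼ t →
                   IsInversion d σ (u , v) ⇔ IsTupleInversion ν T (s , t)
      inversion⇔ {u} {v} {s} {t} u∼s@(cu , ru) v∼t@(cv , rv) = mk⇔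
        (λ (attack , precedes , σv<σu) →
          subst₂ Fin._<_ (agree v∼t) (agree u∼s) σv<σu , contents-related attack precedes)
        (λ { (Tt<Ts , inj₁ (j< , c≡)) →
               let r≡ = +-injective (trans (sym ru) (trans c≡ rv))
                   c< = subst₂ _<_ (sym cu) (sym cv) (s≤s j<)
               in inj₁ (r≡ , λ { refl → <-irrefl refl c< }) , inj₂ (r≡ , c<) , larger Tt<Ts
           ; (Tt<Ts , inj₂ (j< , c≡)) →
               let r≡ = trans (+-injective (trans (sym ru) (trans c≡ (cong (_+ᶻ 1ℤ) rv)))) (+-comm _ 1)
                   c< = subst₂ _<_ (sym cv) (sym cu) (s≤s j<)
               in inj₂ (inj₁ (r≡ , c<)) , inj₁ (≤-reflexive (sym r≡)) , larger Tt<Ts })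
        where
        larger : entry ν T t Fin.< entry ν T s → σ v Fin.< σ u
        larger = subst₂ Fin._<_ (sym (agree v∼t)) (sym (agree u∼s))

        contents-related : Attack d u v → Precedes d u v →
          (proj₁ s Fin.< proj₁ t × tupleContent ν s ≡ tupleContent ν t) ⊎
          (proj₁ t Fin.< proj₁ s × tupleContent ν s ≡ tupleContent ν t +ᶻ 1ℤ)
        contents-related (inj₁ (r≡ , _)) (inj₁ r<) = contradiction r< (<-irrefl (sym r≡))
        contents-related (inj₁ (r≡ , _)) (inj₂ (_ , c<)) =
          inj₁ (≤-pred (subst₂ _<_ cu cv c<) , trans ru (trans (cong +_ r≡) (sym rv)))
        contents-related (inj₂ (inj₁ (r≡ , c<))) _ =
          inj₂ ( ≤-pred (subst₂ _<_ cv cu c<)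
               , trans ru (trans (cong +_ (trans r≡ (+-comm 1 _))) (cong (_+ᶻ 1ℤ) (sym rv))))
        contents-related (inj₂ (inj₂ (r≡ , _))) (inj₁ r<) =
          contradiction r< (<⇒≯ (≤-reflexive (sym r≡)))
        contents-related (inj₂ (inj₂ (r≡ , _))) (inj₂ (r≡′ , _)) =
          contradiction (trans (sym r≡) (sym r≡′)) 1+n≢n

      inv-≡ : ∣Inv∣ d σ ≡ inv ν T
      inv-≡ = count-≡ (λ (u , v) (s , t) → u ∼ s × v ∼ t) (isInversion? d σ) (isTupleInversion? ν T)
        (AllPairs.map (λ p≢q _ (a , b) (a′ , b′) → p≢q (cong₂ _,_ (∼-injectiveˡ a a′) (∼-injectiveˡ b b′)))
          (Unique.cartesianProduct⁺ (Unique.allFin⁺ (length d)) (Unique.allFin⁺ (length d))))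
        (AllPairs.map (λ p≢q _ (a , b) (a′ , b′) → p≢q (cong₂ _,_ (∼-injectiveʳ a a′) (∼-injectiveʳ b b′)))
          (Unique.cartesianProduct⁺ tupleBoxes-unique tupleBoxes-unique))
        (λ {(u , v)} _ i → let s , u∼s = ∼-total u
                               t , v∼t = ∼-total v
                           in (s , t) , ∈-cartesianProduct⁺ (∈-tupleBoxes s) (∈-tupleBoxes t)
                              , to (inversion⇔ u∼s v∼t) i , u∼s , v∼t)
        (λ {(s , t)} _ i → let u , u∼s = ∼-surjective s
                               v , v∼t = ∼-surjective t
                           in (u , v) , ∈-cartesianProduct⁺ (∈-allFin u) (∈-allFin v)
                              , from (inversion⇔ u∼s v∼t) i , u∼s , v∼t)

      semistandard⇒descents : (∀ u → u ∈ D → 1 < row d u) →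
                              (∀ j → IsSemistandard (skewDiagram (ν j)) (T j)) → Des d σ ≡ D
      semistandard⇒descents 1<row ss = ⊆-antisym
        (λ {u} u∈ → from (descent⇔ u) (to (∈-tabulate-does (isDescent? d σ)) u∈))
        (λ {u} u∈ → from (∈-tabulate-does (isDescent? d σ)) (to (descent⇔ u) u∈))
        where
        descent⇔ : ∀ u → u ∈ D ⇔ IsDescent d σ u
        descent⇔ u with (j , b) , cu , _ ← ∼-total u =
          locally⇒descents (ribbons j) σ (T j) agree
            (semistandard⇒locally (ribbons j) (T j) (ss j)) cu (1<row u)

module _ (d : List Cell) {N : ℕ} where

  fillings-distinct : AllPairs (λ σ τ → ¬ (∀ u → σ u ≡ τ u)) (fillings d N)
  fillings-distinct = choices-distinct (λ _ → allFin N) (λ _ → Unique.allFin⁺ N)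

  filling-∈ : (σ : Filling d N) → ∃[ τ ] τ ∈ˡ fillings d N × (∀ u → τ u ≡ σ u)
  filling-∈ σ = find (choices-Any (λ _ → allFin N) λ u → Any.map sym (∈-allFin (σ u)))

proposition3p4 : (μ : Partition) (D : Subset (length (diagram μ))) →
    (∀ u → u ∈ D → 1 < row (diagram μ) u) →
    (ν : Fin (part μ 1) → SkewDiagram) → IsRibbonTuple μ D ν →
    F μ D ≈ G ν
proposition3p4 μ D 1<row ν ribbons {N} α n = count-≡ (Agree ribbons)
  (λ σ → (∣Inv∣ d σ ≟ n) ×-dec ≡-dec _≟_ (weight d σ) α)
  (λ T → (inv ν T ≟ n) ×-dec ≡-dec _≟_ (tupleWeight ν T) α)
  (AllPairs.filter⁺ Des? (AllPairs.map
    (λ σ≢τ _ σ∼T τ∼T → σ≢τ λ u → let _ , u∼t = ∼-total ribbons u in trans (σ∼T u∼t) (sym (τ∼T u∼t)))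
    (fillings-distinct d)))
  (AllPairs.map
    (λ T≢S _ σ∼T σ∼S → T≢S λ j b →
      let _ , u∼t = ∼-surjective ribbons (j , b) in trans (sym (σ∼T u∼t)) (σ∼S u∼t))
    (choices-distinct tableaux λ j →
      AllPairs.filter⁺ (isSemistandard? (skewDiagram (ν j))) (fillings-distinct (skewDiagram (ν j)))))
  (λ {σ} σ∈ (inv≡ , weight≡) →
    let T , T∈ , σ∼T = tableau σ (proj₂ (∈-filter⁻ Des? {xs = fillings d N} σ∈))
    in T , T∈ , (trans (sym (inv-≡ ribbons σ T σ∼T)) inv≡ , trans (sym (weight-≡ ribbons σ T σ∼T)) weight≡)
       , σ∼T)
  (λ {T} T∈ (inv≡ , weight≡) →
    let σ , σ∈ , σ∼T = filling T (All.lookup tuples-semistandard T∈)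
    in σ , σ∈ , (trans (inv-≡ ribbons σ T σ∼T) inv≡ , trans (weight-≡ ribbons σ T σ∼T) weight≡) , σ∼T)
  where
  d = diagram μ

  Des? : Decidable (λ (σ : Filling d N) → Des d σ ≡ D)
  Des? σ = ≡-dec _≟ᵇ_ (Des d σ) D

  tableaux : ∀ j → List (Filling (skewDiagram (ν j)) N)
  tableaux j = SSYT (ν j) N

  tuples-semistandard : All (λ T → ∀ j → IsSemistandard (skewDiagram (ν j)) (T j)) (tupleSSYT ν N)
  tuples-semistandard = choices-All {P = λ j → IsSemistandard (skewDiagram (ν j))} tableaux λ j →
    All.all-filter (isSemistandard? (skewDiagram (ν j))) (fillings (skewDiagram (ν j)) N)

  tableau : ∀ σ → Des d σ ≡ D → ∃[ T ] T ∈ˡ tupleSSYT ν N × Agree ribbons σ T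
  tableau σ des = let T , T∈ , T≡ = find (choices-Any tableaux column)
                  in T , T∈ , λ { {t = j , b} u∼t → transport j u∼t (T≡ j b) }
    where
    transport : ∀ j {u b x} → Matches μ (suc (toℕ j)) (ν j) u b →
                x ≡ σ (proj₁ (∼-surjective ribbons (j , b))) → σ u ≡ x
    transport j {b = b} u∼t x≡ =
      trans (cong σ (∼-injectiveˡ ribbons {t = j , b} u∼t (proj₂ (∼-surjective ribbons (j , b))))) (sym x≡)

    column : ∀ j → Any (λ Tⱼ → ∀ b → Tⱼ b ≡ σ (proj₁ (∼-surjective ribbons (j , b)))) (tableaux j)
    column j =
      let Tⱼ , Tⱼ∈ , Tⱼ≡ = filling-∈ (skewDiagram (ν j)) (λ b → σ (proj₁ (∼-surjective ribbons (j , b))))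
          ss = descents⇒semistandard ribbons σ j Tⱼ (λ {u} {b} u∼b → transport j {u} {b} u∼b (Tⱼ≡ b)) des
      in lose (∈-filter⁺ (isSemistandard? (skewDiagram (ν j))) Tⱼ∈ ss) Tⱼ≡

  filling : ∀ T → (∀ j → IsSemistandard (skewDiagram (ν j)) (T j)) →
            ∃[ σ ] σ ∈ˡ filter Des? (fillings d N) × Agree ribbons σ T
  filling T ss =
    let σ , σ∈ , σ≡ = filling-∈ d (λ u → entry ν T (proj₁ (∼-total ribbons u)))
        agree = extend σ σ≡
    in σ , ∈-filter⁺ Des? σ∈ (semistandard⇒descents ribbons σ T agree 1<row ss) , agree
    where
    extend : ∀ σ → (∀ u → σ u ≡ entry ν T (proj₁ (∼-total ribbons u))) → Agree ribbons σ T
    extend σ σ≡ {u} {t} u∼t = let s , u∼s = ∼-total ribbons u in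
      trans (σ≡ u) (cong (entry ν T) (∼-injectiveʳ ribbons {u} {s} {t} u∼s u∼t))
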